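{- Let $\mathcal{A}=(A;\theta)$ be a monounary algebra. Then $\mathcal{A}$ is ultrahomogeneous if and only if, whenever $x,y\in A$ are such that $\langle x\rangle\cong\langle y\rangle$, then $|\theta^{ -1}(x)|=|\theta^{ -1}(y)|$ and the connected components of $\mathcal{A}$ containing $x$ and $y$ are isomorphic.
   Context: A monounary algebra is a pair $\mathcal{A}=(A;\theta)$ where $A$ is a nonempty set (of arbitrary cardinality) and $\theta\colon A\to A$ is a function. A subalgebra is a nonempty subset closed under $\theta$, with the restricted operation; $\langle x\rangle=\{\theta^n(x): n\geq 0\}$ is the subalgebra generated by $x$. Isomorphisms are bijections commuting with the unary operations. $\mathcal{A}$ is connected if for all $x,y\in A$ there are $n,m\geq 0$ with $\theta^n(x)=\theta^m(y)$; a connected component of $\mathcal{A}$ is a maximal connected subalgebra. $\theta^{ -1}(x)=\{a\in A:\theta(a)=x\}$. $\mathcal{A}$ is ultrahomogeneous if every isomorphism between finitely generated subalgebras of $\mathcal{A}$ extends to an automorphism of $\mathcal{A}$. -}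

module Defs where

open import Axiom.ExcludedMiddle using (ExcludedMiddle)
open import Data.Irrelevant using ([_])
open import Data.List.Base using (List)
open import Data.List.Relation.Unary.All using (All)
open import Data.Nat.Base using (ℕ; zero; suc; _+_)
open import Data.Nat.Properties using (+-comm)
open import Data.Product.Base using (Σ-syntax; ∃; ∃₂; _×_; _,_; proj₁; proj₂)
open import Data.Refinement as Refinement using (Refinement-syntax; value; value-injective; _,_)
open import Function.Bundles using (_↔_; Inverse)
import Function.Endo.Propositional as Endo
open import Level using (Level; _⊔_) renaming (suc to lsuc)
open import Relation.Binary.PropositionalEquality
open import Relation.Nullary.Decidable.Core using (recompute)
open import Relation.Unary using (Pred; _∈_; _⊆_; Satisfiable)

private
  variable
    a b : Level

record MonounaryAlgebra (a : Level) : Set (lsuc a) where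
  field
    Carrier  : Set a
    θ        : Carrier → Carrier
    nonempty : Carrier

  open Endo Carrier using (_^_)

  θ^ : ℕ → Carrier → Carrier
  θ^ n = θ ^ n

  -- The fibre is a subset of the carrier: the equation θ z ≡ x is held
  -- irrelevantly, so its elements are equal as soon as they are equal
  -- in the carrier.
  θ⁻¹ : Carrier → Set a
  θ⁻¹ x = [ z ∈ Carrier ∣ θ z ≡ x ]

  Connected : Set a
  Connected = ∀ x y → ∃₂ λ n m → θ^ n x ≡ θ^ m y

infix 4 _≅_

record _≅_ (𝒜 : MonounaryAlgebra a) (ℬ : MonounaryAlgebra b) : Set (a ⊔ b) where
  private
    module A = MonounaryAlgebra 𝒜
    module B = MonounaryAlgebra ℬ
  field
    bijection : A.Carrier ↔ B.Carrier
  open Inverse bijection public using (to; from)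
  field
    homo : ∀ x → to (A.θ x) ≡ B.θ (to x)

module _ (𝒜 : MonounaryAlgebra a) where
  open MonounaryAlgebra 𝒜

  record Subalgebra : Set (lsuc a) where
    field
      member    : Pred Carrier a
      inhabited : Satisfiable member
      closed    : ∀ {x} → x ∈ member → θ x ∈ member

    -- Membership is irrelevant here for the same reason as in θ⁻¹:
    -- equality of elements is equality in 𝒜.
    algebra : MonounaryAlgebra a
    algebra = record
      { Carrier  = [ x ∈ Carrier ∣ x ∈ member ]
      ; θ        = Refinement.map θ closed
      ; nonempty = proj₁ inhabited , [ proj₂ inhabited ]
      }

  open Subalgebra

  ⟨_⟩ : Carrier → Subalgebra
  ⟨ x ⟩ = record
    { member    = λ y → ∃ λ n → θ^ n x ≡ y
    ; inhabited = x , 0 , refl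
    ; closed    = λ (n , θⁿx≡y) → suc n , cong θ θⁿx≡y
    }

  FinitelyGenerated : Subalgebra → Set (lsuc a)
  FinitelyGenerated B =
    Σ[ xs ∈ List Carrier ]
      All (_∈ member B) xs ×
      (∀ (C : Subalgebra) → All (_∈ member C) xs → member B ⊆ member C)

  IsConnectedComponent : Subalgebra → Set (lsuc a)
  IsConnectedComponent D =
    MonounaryAlgebra.Connected (algebra D) ×
    (∀ (E : Subalgebra) → MonounaryAlgebra.Connected (algebra E) →
       member D ⊆ member E → member E ⊆ member D)

  Extends : {B C : Subalgebra} → 𝒜 ≅ 𝒜 → algebra B ≅ algebra C → Set a
  Extends α φ = ∀ x → _≅_.to α (value x) ≡ value (_≅_.to φ x)

  Ultrahomogeneous : Set (lsuc a)
  Ultrahomogeneous =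
    ∀ (B C : Subalgebra) → FinitelyGenerated B → FinitelyGenerated C →
    (φ : algebra B ≅ algebra C) → Σ[ α ∈ 𝒜 ≅ 𝒜 ] Extends {B} {C} α φ

  θ^-+ : ∀ m n x → θ^ (m + n) x ≡ θ^ m (θ^ n x)
  θ^-+ zero    n x = refl
  θ^-+ (suc m) n x = cong θ (θ^-+ m n x)

  θ^-comm : ∀ m n x → θ^ m (θ^ n x) ≡ θ^ n (θ^ m x)
  θ^-comm m n x = begin
    θ^ m (θ^ n x) ≡⟨ θ^-+ m n x ⟨
    θ^ (m + n) x  ≡⟨ cong (λ k → θ^ k x) (+-comm m n) ⟩
    θ^ (n + m) x  ≡⟨ θ^-+ n m x ⟩
    θ^ n (θ^ m x) ∎
    where open ≡-Reasoning

  value-θ^ : ∀ (B : Subalgebra) n x →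
             value (MonounaryAlgebra.θ^ (algebra B) n x) ≡ θ^ n (value x)
  value-θ^ B zero    x = refl
  value-θ^ B (suc n) x = cong θ (value-θ^ B n x)

  -- Every element lies in a connected component, so quantifying over
  -- the components containing it is not vacuous.
  connectedComponent : ExcludedMiddle a → ∀ x →
    Σ[ D ∈ Subalgebra ] IsConnectedComponent D × x ∈ member D
  connectedComponent em x = D , (connected , maximal) , 0 , 0 , refl
    where
    D : Subalgebra
    D = record
      { member    = λ y → ∃₂ λ n m → θ^ n x ≡ θ^ m y
      ; inhabited = x , 0 , 0 , refl
      ; closed    = λ {y} (n , m , eq) →
          suc n , m , trans (cong θ eq) (θ^-comm 1 m y)
      }

    connected : MonounaryAlgebra.Connected (algebra D)
    connected u@(y , [ y∈D ]) v@(z , [ z∈D ])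
      with n , m , p ← recompute em y∈D | k , l , q ← recompute em z∈D =
      k + m , n + l , value-injective (begin
        value (θᴰ^ (k + m) u) ≡⟨ value-θ^ D (k + m) u ⟩
        θ^ (k + m) y          ≡⟨ θ^-+ k m y ⟩
        θ^ k (θ^ m y)         ≡⟨ cong (θ^ k) p ⟨
        θ^ k (θ^ n x)         ≡⟨ θ^-comm k n x ⟩
        θ^ n (θ^ k x)         ≡⟨ cong (θ^ n) q ⟩
        θ^ n (θ^ l z)         ≡⟨ θ^-+ n l z ⟨
        θ^ (n + l) z          ≡⟨ value-θ^ D (n + l) v ⟨
        value (θᴰ^ (n + l) v) ∎)
      where
      open ≡-Reasoning
      open MonounaryAlgebra (algebra D) using () renaming (θ^ to θᴰ^)

    maximal : ∀ E → MonounaryAlgebra.Connected (algebra E) →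
              member D ⊆ member E → member E ⊆ member D
    maximal E conn D⊆E {y} y∈E
      with n , m , eq ← conn (x , [ D⊆E (0 , 0 , refl) ]) (y , [ y∈E ]) =
      n , m , (begin
        θ^ n x ≡⟨ value-θ^ E n _ ⟨
        _      ≡⟨ cong value eq ⟩
        _      ≡⟨ value-θ^ E m _ ⟩
        θ^ m y ∎)
      where open ≡-Reasoning

-- For the converse, two points x and y with ⟨ x ⟩ ≅ ⟨ y ⟩ satisfy the same
-- equations θⁿ = θᵐ, so θⁿ x ↦ θⁿ y is well defined.  It extends to an
-- isomorphism between their components by recursion on the distance to the
-- orbits: the given fibre bijections, corrected by finitely many
-- transpositions to follow the orbits, preserve this type, because off the
-- orbits no point is periodic and the type of z is determined by that of θ z.
-- An isomorphism φ between finitely generated subalgebras is then realised one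
-- generator x at a time.  If α agrees with φ on the earlier generators, let F
-- be the part of the image of α where the two agree; the component of α x in
-- the complement of F is equal to or disjoint from that of φ x, and exchanging
-- the two by the isomorphism above is an automorphism fixing F and sending
-- α x to φ x.
module Submission where

open import Defs
open import Axiom.ExcludedMiddle using (ExcludedMiddle)
open import Data.Irrelevant using (Irrelevant; [_])
open import Data.List.Base using (List; []; _∷_; _++_)
open import Data.List.Relation.Unary.All as All using (All; []; _∷_)
open import Data.List.Relation.Unary.Any as Any using (Any; here)
import Data.List.Relation.Unary.Any.Properties as Any
open import Data.Nat.Base using (ℕ; zero; suc; _+_; _∸_; _<_; _≤_)
open import Data.Nat.Properties using (<-cmp; ≤-total; m∸n+n≡m)
open import Data.Product.Base using (Σ-syntax; ∃; ∃₂; _×_; _,_; proj₁; proj₂)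
open import Data.Refinement using (Refinement-syntax; value; value-injective; _,_)
open import Data.Sum.Base using (_⊎_; inj₁; inj₂; swap)
open import Function.Base using (_∘_; const)
open import Function.Bundles using (_↔_; _⇔_; Inverse; Injection; mk↔ₛ′; mk⇔)
open import Function.Construct.Composition using (_↔-∘_)
open import Function.Properties.Inverse using (↔-refl; ↔-sym; ↔⇒↣)
open import Level using (Level) renaming (suc to lsuc)
open import Relation.Binary.Definitions using (tri<; tri≈; tri>)
open import Relation.Binary.PropositionalEquality
open import Relation.Nullary using (¬_; Dec; yes; no; contradiction; recompute)
open import Relation.Unary using (Pred; _∈_)

private
  variable
    a b c : Level

-- Isomorphisms of monounary algebras.

↔-injective : {X : Set a} {Y : Set b} (h : X ↔ Y) {x y : X} →
              Inverse.to h x ≡ Inverse.to h y → x ≡ y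
↔-injective h = Injection.injective (↔⇒↣ h)

module _ {𝒜 : MonounaryAlgebra a} where
  ≅-refl : 𝒜 ≅ 𝒜
  ≅-refl = record { bijection = ↔-refl ; homo = λ _ → refl }

  module _ {ℬ : MonounaryAlgebra b} where
    private
      module A = MonounaryAlgebra 𝒜
      module B = MonounaryAlgebra ℬ

    ≅-sym : 𝒜 ≅ ℬ → ℬ ≅ 𝒜
    ≅-sym φ = record
      { bijection = ↔-sym bijection
      ; homo      = λ y → ↔-injective bijection (begin
          to (from (B.θ y))   ≡⟨ strictlyInverseˡ (B.θ y) ⟩
          B.θ y               ≡⟨ cong B.θ (strictlyInverseˡ y) ⟨
          B.θ (to (from y))   ≡⟨ homo (from y) ⟨
          to (A.θ (from y))   ∎)
      }
      where
      open _≅_ φ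
      open Inverse bijection using (strictlyInverseˡ)
      open ≡-Reasoning

    ≅-trans : {𝒞 : MonounaryAlgebra c} → 𝒜 ≅ ℬ → ℬ ≅ 𝒞 → 𝒜 ≅ 𝒞
    ≅-trans φ ψ = record
      { bijection = ψ.bijection ↔-∘ φ.bijection
      ; homo      = λ x → trans (cong ψ.to (φ.homo x)) (ψ.homo (φ.to x))
      }
      where
      module φ = _≅_ φ
      module ψ = _≅_ ψ

    homo-θ^ : (φ : 𝒜 ≅ ℬ) → ∀ n x → _≅_.to φ (A.θ^ n x) ≡ B.θ^ n (_≅_.to φ x)
    homo-θ^ φ zero    x = refl
    homo-θ^ φ (suc n) x = trans (_≅_.homo φ _) (cong B.θ (homo-θ^ φ n x))

-- Exchanging two sets, and bijections with finitely many prescribed values.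

record Exchangeable {X : Set a} (P Q : Pred X a) (f g : X → X) : Set a where
  field
    to-∈     : ∀ {x} → P x → Q (f x)
    from-∈   : ∀ {x} → Q x → P (g x)
    from∘to  : ∀ {x} → P x → g (f x) ≡ x
    to∘from  : ∀ {x} → Q x → f (g x) ≡ x
    -- P and Q are equal or disjoint.
    overlapˡ : ∀ {x y} → P x → Q x → Q y → P y
    overlapʳ : ∀ {x y} → P x → Q x → P y → Q y

exchangeable-sym : {X : Set a} {P Q : Pred X a} {f g : X → X} →
                   Exchangeable P Q f g → Exchangeable Q P g f
exchangeable-sym ex = record
  { to-∈     = from-∈
  ; from-∈   = to-∈
  ; from∘to  = to∘from
  ; to∘from  = from∘to
  ; overlapˡ = λ q p → overlapʳ p q
  ; overlapʳ = λ q p → overlapˡ p q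
  }
  where open Exchangeable ex

module _ (em : ExcludedMiddle a) where

  module _ {X : Set a} where

    -- `P` takes precedence over `Q`: if the two sets coincide, the result acts as `f` on them, and
    -- the exchange with the roles swapped acts as `g`. Values of `f` off `P` and of `g` off `Q`
    -- never matter.
    exchange : (P Q : Pred X a) (f g : X → X) → X → X
    exchange P Q f g x with em {P x} | em {Q x}
    ... | yes _ | _     = f x
    ... | no _  | yes _ = g x
    ... | no _  | no _  = x

    module _ {P Q : Pred X a} {f g : X → X} where

      exchange-fst : ∀ {x} → P x → exchange P Q f g x ≡ f x
      exchange-fst {x} p with em {P x} | em {Q x}
      ... | yes _ | _ = refl
      ... | no ¬p | _ = contradiction p ¬p

      exchange-snd : ∀ {x} → ¬ P x → Q x → exchange P Q f g x ≡ g x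
      exchange-snd {x} ¬p q with em {P x} | em {Q x}
      ... | yes p | _     = contradiction p ¬p
      ... | no _  | yes _ = refl
      ... | no _  | no ¬q = contradiction q ¬q

      exchange-off : ∀ {x} → ¬ P x → ¬ Q x → exchange P Q f g x ≡ x
      exchange-off {x} ¬p ¬q with em {P x} | em {Q x}
      ... | yes p | _     = contradiction p ¬p
      ... | no _  | yes q = contradiction q ¬q
      ... | no _  | no _  = refl

    exchange-inverse : ∀ {P Q : Pred X a} {f g} → Exchangeable P Q f g → ∀ x →
                       exchange Q P g f (exchange P Q f g x) ≡ x
    exchange-inverse {P} {Q} {f} {g} ex x with em {P x} | em {Q x}
    ... | yes p | _     = trans (exchange-fst (to-∈ p)) (from∘to p)
      where open Exchangeable ex
    ... | no ¬p | yes q =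
      -- If `g x` lay in `Q` as well as in `P`, the two sets would meet and hence coincide, putting
      -- `x` in `P`.
      trans (exchange-snd (λ q′ → ¬p (overlapˡ (from-∈ q) q′ q)) (from-∈ q)) (to∘from q)
      where open Exchangeable ex
    ... | no ¬p | no ¬q = exchange-off ¬q ¬p

    exchange-↔ : ∀ {P Q : Pred X a} {f g} → Exchangeable P Q f g → X ↔ X
    exchange-↔ {P} {Q} {f} {g} ex =
      mk↔ₛ′ (exchange P Q f g) (exchange Q P g f)
        (exchange-inverse (exchangeable-sym ex)) (exchange-inverse ex)

    transposition : (y z : X) → Exchangeable (_≡ y) (_≡ z) (const z) (const y)
    transposition y z = record
      { to-∈     = λ _ → refl
      ; from-∈   = λ _ → refl
      ; from∘to  = sym
      ; to∘from  = sym
      ; overlapˡ = λ { refl refl refl → refl }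
      ; overlapʳ = λ { refl refl refl → refl }
      }

  -- Each index costs one transposition, applied after the rest of the list is settled. It does not
  -- spoil a value already right, because `x` and `y` identify the same indices and `h′` is
  -- injective.
  prescribe : {I : Set b} {X Y : Set a} (x : I → X) (y : I → Y) →
              (∀ i j → x i ≡ x j → y i ≡ y j) → (∀ i j → y i ≡ y j → x i ≡ x j) →
              X ↔ Y → ∀ is → Σ[ h ∈ X ↔ Y ] All (λ i → Inverse.to h (x i) ≡ y i) is
  prescribe x y x⇒y y⇒x h []       = h , []
  prescribe x y x⇒y y⇒x h (i ∷ is)
    with h′ , h′≡y ← prescribe x y x⇒y y⇒x h is =
      exchange-↔ (transposition (to (x i)) (y i)) ↔-∘ h′
    , exchange-fst refl
    ∷ All.map still h′≡y
    where
    open Inverse h′ using (to)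
    still : ∀ {j} → to (x j) ≡ y j →
            exchange (_≡ to (x i)) (_≡ y i) (const (y i)) (const (to (x i))) (to (x j)) ≡ y j
    still {j} eq with em {x j ≡ x i}
    ... | yes same = trans (exchange-fst (cong to same)) (sym (x⇒y _ i same))
    ... | no ¬same =
      trans (exchange-off (¬same ∘ ↔-injective h′)
                          (λ eq′ → ¬same (y⇒x _ i (trans (sym eq) eq′))))
            eq

  covering : {I : Set a} {X : Set a} (val : I → X) (Q : Pred I a) →
             (∀ {i j} → Q i → Q j → val i ≡ val j) →
             Σ[ is ∈ List I ] (∀ j → Q j → Any (λ i → val i ≡ val j) is)
  covering val Q unique with em {∃ Q}
  ... | yes (i , q) = i ∷ [] , λ j q′ → here (unique q q′)
  ... | no  ¬q      = []     , λ j q  → contradiction (j , q) ¬q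

-- Types of points, cycles, and orbits meeting a fibre.

module _ (em : ExcludedMiddle a) (𝒜 : MonounaryAlgebra a) where
  open MonounaryAlgebra 𝒜
  open Subalgebra

  private
    ⟨_⟩′ : Carrier → Pred Carrier a
    ⟨ x ⟩′ = member (⟨_⟩ 𝒜 x)

  θ^-∸ : ∀ {m n} → m ≤ n → ∀ x → θ^ (n ∸ m) (θ^ m x) ≡ θ^ n x
  θ^-∸ {m} {n} m≤n x =
    trans (sym (θ^-+ 𝒜 (n ∸ m) m x)) (cong (λ k → θ^ k x) (m∸n+n≡m m≤n))

  infix 4 _⊑_ _∼_

  -- This is exactly what makes θⁿ x ↦ θⁿ y a well-defined homomorphism from ⟨ x ⟩ onto ⟨ y ⟩.
  _⊑_ : Carrier → Carrier → Set a
  x ⊑ y = ∀ n m → θ^ n x ≡ θ^ m x → θ^ n y ≡ θ^ m y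

  -- Equivalent to ⟨ x ⟩ ≅ ⟨ y ⟩.
  _∼_ : Carrier → Carrier → Set a
  x ∼ y = x ⊑ y × y ⊑ x

  ∼-sym : ∀ {x y} → x ∼ y → y ∼ x
  ∼-sym (p , q) = q , p

  ∼-trans : ∀ {x y z} → x ∼ y → y ∼ z → x ∼ z
  ∼-trans (p , q) (p′ , q′) = (λ n m → p′ n m ∘ p n m) , (λ n m → q n m ∘ q′ n m)

  ⊑-θ^ : ∀ k {x y} → x ⊑ y → θ^ k x ⊑ θ^ k y
  ⊑-θ^ k {x} {y} x⊑y n m eq = begin
    θ^ n (θ^ k y) ≡⟨ θ^-+ 𝒜 n k y ⟨
    θ^ (n + k) y  ≡⟨ x⊑y (n + k) (m + k) (begin
      θ^ (n + k) x  ≡⟨ θ^-+ 𝒜 n k x ⟩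
      θ^ n (θ^ k x) ≡⟨ eq ⟩
      θ^ m (θ^ k x) ≡⟨ θ^-+ 𝒜 m k x ⟨
      θ^ (m + k) x  ∎) ⟩
    θ^ (m + k) y  ≡⟨ θ^-+ 𝒜 m k y ⟩
    θ^ m (θ^ k y) ∎
    where open ≡-Reasoning

  Cyclic : Pred Carrier a
  Cyclic x = ∃ λ k → θ^ (suc k) x ≡ x

  θ-cyclic : ∀ {x} → Cyclic x → Cyclic (θ x)
  θ-cyclic (k , eq) = k , trans (θ^-comm 𝒜 (suc k) 1 _) (cong θ eq)

  cyclic⇒∈⟨θ⟩ : ∀ {x} → Cyclic x → x ∈ ⟨ θ x ⟩′
  cyclic⇒∈⟨θ⟩ (k , eq) = k , trans (θ^-comm 𝒜 k 1 _) eq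

  -- An equation between powers at a noncyclic `x` is trivial or has positive exponents on both
  -- sides; in the latter case it is an equation at `θ x`.
  ⊑-of-θ : ∀ {x y} → ¬ Cyclic x → θ x ⊑ θ y → x ⊑ y
  ⊑-of-θ ¬cyc θx⊑θy zero    zero    eq = refl
  ⊑-of-θ ¬cyc θx⊑θy zero    (suc m) eq = contradiction (m , sym eq) ¬cyc
  ⊑-of-θ ¬cyc θx⊑θy (suc n) zero    eq = contradiction (n , eq) ¬cyc
  ⊑-of-θ {x} {y} ¬cyc θx⊑θy (suc n) (suc m) eq = begin
    θ (θ^ n y) ≡⟨ θ^-comm 𝒜 n 1 y ⟨
    θ^ n (θ y) ≡⟨ θx⊑θy n m (begin
      θ^ n (θ x) ≡⟨ θ^-comm 𝒜 n 1 x ⟩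
      θ (θ^ n x) ≡⟨ eq ⟩
      θ (θ^ m x) ≡⟨ θ^-comm 𝒜 m 1 x ⟨
      θ^ m (θ x) ∎) ⟩
    θ^ m (θ y) ≡⟨ θ^-comm 𝒜 m 1 y ⟩
    θ (θ^ m y) ∎
    where open ≡-Reasoning

  -- Writing y = θᵏ p and z = θˡ p, both k + 1 and l + 1 are periods of `p`, so θᵏ p and θˡ p both
  -- equal θᵏ⁺ˡ⁺¹ p.
  cyclic-fibre : ∀ {p y z} → θ y ≡ p → θ z ≡ p → y ∈ ⟨ p ⟩′ → z ∈ ⟨ p ⟩′ → y ≡ z
  cyclic-fibre {p} θy≡p θz≡p (k , refl) (l , refl) = begin
    θ^ k p                ≡⟨ cong (θ^ k) θz≡p ⟨
    θ^ k (θ^ (suc l) p)   ≡⟨ θ^-comm 𝒜 k (suc l) p ⟩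
    θ (θ^ l (θ^ k p))     ≡⟨ θ^-comm 𝒜 l 1 (θ^ k p) ⟨
    θ^ l (θ^ (suc k) p)   ≡⟨ cong (θ^ l) θy≡p ⟩
    θ^ l p                ∎
    where open ≡-Reasoning

  -- At most one element of ⟨ u ⟩ in the fibre of p lies in ⟨ p ⟩, by cyclic-fibre,
  -- and at most one lies outside, since the orbit of u stays in ⟨ p ⟩ after
  -- reaching p.
  orbit-fibre : ∀ u p →
    Σ[ is ∈ List (∃ λ j → θ^ (suc j) u ≡ p) ]
      (∀ (j : ∃ λ j → θ^ (suc j) u ≡ p) → Any (λ i → θ^ (proj₁ i) u ≡ θ^ (proj₁ j) u) is)
  orbit-fibre u p = proj₁ inner ++ proj₁ outer , λ j → covers j em
    where
    I = ∃ λ j → θ^ (suc j) u ≡ p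
    val : I → Carrier
    val (j , _) = θ^ j u

    inside : ∀ {i j : I} → val i ∈ ⟨ p ⟩′ → val j ∈ ⟨ p ⟩′ → val i ≡ val j
    inside {_ , eq} {_ , eq′} = cyclic-fibre eq eq′

    later : ∀ {i j : I} → proj₁ i < proj₁ j → val j ∈ ⟨ p ⟩′
    later {i , eq} {j , _} i<j = j ∸ suc i , trans (cong (θ^ (j ∸ suc i)) (sym eq)) (θ^-∸ i<j u)

    outside : ∀ {i j : I} → ¬ val i ∈ ⟨ p ⟩′ → ¬ val j ∈ ⟨ p ⟩′ → val i ≡ val j
    outside {i} {j} i∉ j∉ with <-cmp (proj₁ i) (proj₁ j)
    ... | tri< i<j _ _ = contradiction (later {i} {j} i<j) j∉
    ... | tri≈ _ eq _  = cong (λ k → θ^ k u) eq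
    ... | tri> _ _ j<i = contradiction (later {j} {i} j<i) i∉

    inner = covering em val (λ i → val i ∈ ⟨ p ⟩′) (λ {i} {j} → inside {i} {j})
    outer = covering em val (λ i → ¬ val i ∈ ⟨ p ⟩′) (λ {i} {j} → outside {i} {j})

    covers : ∀ j → Dec (val j ∈ ⟨ p ⟩′) →
             Any (λ i → val i ≡ val j) (proj₁ inner ++ proj₁ outer)
    covers j (yes j∈) = Any.++⁺ˡ (proj₂ inner j j∈)
    covers j (no  j∉) = Any.++⁺ʳ (proj₁ inner) (proj₂ outer j j∉)

  -- Lifting a correspondence of orbits along the fibres.

  fibre-θ : ∀ {x} (z : θ⁻¹ x) → θ (value z) ≡ x
  fibre-θ (z , [ eq ]) = recompute em eq

  -- R p q is irrelevant in fibre, so that the bijection chosen depends only on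
  -- the points p and q.
  record Correspondence (u v : Carrier) : Set (lsuc a) where
    field
      R            : Carrier → Carrier → Set a
      orbit        : ∀ i → R (θ^ i u) (θ^ i v)
      functional   : ∀ i {y} → R (θ^ i u) y → y ≡ θ^ i v
      cofunctional : ∀ i {x} → R x (θ^ i v) → x ≡ θ^ i u
      fibre        : ∀ p q → .(R p q) → θ⁻¹ p ↔ θ⁻¹ q
      fibre-R      : ∀ p q .(r : R p q) z →
                     Irrelevant (R (value z) (value (Inverse.to (fibre p q r) z)))

  opposite : ∀ {u v} → Correspondence u v → Correspondence v u
  opposite C = record
    { R            = λ q p → R p q
    ; orbit        = orbit
    ; functional   = cofunctional
    ; cofunctional = functional
    ; fibre        = λ q p r → ↔-sym (fibre p q r)
    ; fibre-R      = λ q p r z →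
        subst (λ w → Irrelevant (R (value (Inverse.from (fibre p q r) z)) (value w)))
              (Inverse.strictlyInverseˡ (fibre p q r) z)
              (fibre-R p q r _)
    }
    where open Correspondence C

  _⟶_ : Carrier → Carrier → Set a
  x ⟶ u = ∃₂ λ n m → θ^ n x ≡ θ^ m u

  θ^-θ : ∀ n {x y} → θ^ (suc n) x ≡ y → θ^ n (θ x) ≡ y
  θ^-θ n {x} eq = trans (θ^-comm 𝒜 n 1 x) eq

  module Lift {u v : Carrier} (C : Correspondence u v) where
    open Correspondence C

    step : ∀ x → [ q ∈ Carrier ∣ R (θ x) q ] → [ y ∈ Carrier ∣ R x y ]
    step x (q , [ r ]) =
      value (Inverse.to (fibre (θ x) q r) (x , [ refl ])) , fibre-R (θ x) q r (x , [ refl ])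

    θ-step : ∀ x q → θ (value (step x q)) ≡ value q
    θ-step x (q , [ r ]) = fibre-θ (Inverse.to (fibre (θ x) q r) (x , [ refl ]))

    -- Recursion on the number `n` of steps to the orbit of `u`: orbit points are sent by index, and
    -- any other point follows the fibre bijection over the image of `θ x`.
    lift : ∀ n m x → .(θ^ n x ≡ θ^ m u) → [ y ∈ Carrier ∣ R x y ]
    lift zero    m x eq = θ^ m v , [ subst (λ z → R z (θ^ m v)) (sym eq) (orbit m) ]
    lift (suc n) m x eq = step x (lift n m (θ x) (θ^-θ n eq))

    on-orbit : ∀ {x} m → x ≡ θ^ m u → (y : [ y ∈ Carrier ∣ R x y ]) → value y ≡ θ^ m v
    on-orbit m refl (y , [ r ]) = functional m (recompute em r)

    -- The exponents need not be least. As soon as one of `n`, `n′` is zero, the point is on the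
    -- orbit of `u`, where functionality of `R` leaves only one value.
    lift-unique : ∀ n m n′ m′ x (eq : θ^ n x ≡ θ^ m u) (eq′ : θ^ n′ x ≡ θ^ m′ u) →
                  lift n m x eq ≡ lift n′ m′ x eq′
    lift-unique zero    m n′       m′ x eq eq′ =
      value-injective (sym (on-orbit m eq (lift n′ m′ x eq′)))
    lift-unique (suc n) m zero     m′ x eq eq′ =
      value-injective (on-orbit m′ eq′ (lift (suc n) m x eq))
    lift-unique (suc n) m (suc n′) m′ x eq eq′ =
      cong (step x) (lift-unique n m n′ m′ (θ x) (θ^-θ n eq) (θ^-θ n′ eq′))

    θ^-lift : ∀ n m x (eq : θ^ n x ≡ θ^ m u) → θ^ n (value (lift n m x eq)) ≡ θ^ m v
    θ^-lift zero    m x eq = refl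
    θ^-lift (suc n) m x eq =
      trans (sym (θ^-comm 𝒜 n 1 _))
        (trans (cong (θ^ n) (θ-step x (lift n m (θ x) _))) (θ^-lift n m (θ x) (θ^-θ n eq)))

    lift-θ : ∀ n m n′ m′ x (eq : θ^ n x ≡ θ^ m u) (eq′ : θ^ n′ (θ x) ≡ θ^ m′ u) →
             value (lift n′ m′ (θ x) eq′) ≡ θ (value (lift n m x eq))
    lift-θ zero    m n′ m′ x eq eq′ = on-orbit (suc m) (cong θ eq) (lift n′ m′ (θ x) eq′)
    lift-θ (suc n) m n′ m′ x eq eq′ =
      trans (cong value (lift-unique n′ m′ n m (θ x) eq′ (θ^-θ n eq)))
            (sym (θ-step x (lift n m (θ x) (θ^-θ n eq))))

    -- The identity off the component of u is a junk value.
    extend : Carrier → Carrier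
    extend x with em {x ⟶ u}
    ... | yes (n , m , eq) = value (lift n m x eq)
    ... | no  _            = x

    extend-lift : ∀ n m x (eq : θ^ n x ≡ θ^ m u) → extend x ≡ value (lift n m x eq)
    extend-lift n m x eq with em {x ⟶ u}
    ... | yes (n′ , m′ , eq′) = cong value (lift-unique n′ m′ n m x eq′ eq)
    ... | no  ¬x⟶u            = contradiction (n , m , eq) ¬x⟶u

    extend-orbit : ∀ m → extend (θ^ m u) ≡ θ^ m v
    extend-orbit m = extend-lift 0 m (θ^ m u) refl

    extend-θ : ∀ {x} → x ⟶ u → extend (θ x) ≡ θ (extend x)
    extend-θ {x} (n , m , eq) =
      trans (extend-lift n (suc m) (θ x) eq′)
        (trans (lift-θ n m n (suc m) x eq eq′) (cong θ (sym (extend-lift n m x eq))))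
      where
      eq′ : θ^ n (θ x) ≡ θ^ (suc m) u
      eq′ = θ^-θ n (cong θ eq)

    θ^-extend : ∀ n m {x} → θ^ n x ≡ θ^ m u → θ^ n (extend x) ≡ θ^ m v
    θ^-extend n m {x} eq =
      trans (cong (θ^ n) (extend-lift n m x eq)) (θ^-lift n m x eq)

  module _ {u v : Carrier} (C : Correspondence u v) where
    open Correspondence C
    private
      module L = Lift C
      module L⁻¹ = Lift (opposite C)

    -- Replaces base points that are only propositionally equal; the proofs about them may differ on
    -- the two sides because they are irrelevant.
    from-fibre-cong : ∀ {p p′ q q′ y y′} → p ≡ p′ → q ≡ q′ → y ≡ y′ →
      .{r : R p q} .{r′ : R p′ q′} .{eq : θ y ≡ q} .{eq′ : θ y′ ≡ q′} →
      value (Inverse.from (fibre p q r) (y , [ eq ])) ≡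
      value (Inverse.from (fibre p′ q′ r′) (y′ , [ eq′ ]))
    from-fibre-cong refl refl refl = refl

    step-inverse : ∀ x q (p : [ p ∈ Carrier ∣ R p (θ (value (L.step x q))) ]) →
                   value p ≡ θ x → value (L⁻¹.step (value (L.step x q)) p) ≡ x
    step-inverse x (q , [ r ]) (p , [ r′ ]) p≡θx =
      trans (from-fibre-cong p≡θx (fibre-θ z) refl)
            (cong value (Inverse.strictlyInverseʳ (fibre (θ x) q r) (x , [ refl ])))
      where z = Inverse.to (fibre (θ x) q r) (x , [ refl ])

    -- `y` is a separate variable because the induction hypothesis is needed at `θ y`, which equals
    -- the lift of `θ x` only through `θ-step`.
    lift-inverse : ∀ n m x y (eq : θ^ n x ≡ θ^ m u) (eq′ : θ^ n y ≡ θ^ m v) →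
                   y ≡ value (L.lift n m x eq) → value (L⁻¹.lift n m y eq′) ≡ x
    lift-inverse zero    m x y eq eq′ _    = sym eq
    lift-inverse (suc n) m x y eq eq′ refl =
      step-inverse x q (L⁻¹.lift n m (θ y) (θ^-θ n eq′))
        (lift-inverse n m (θ x) (θ y) (θ^-θ n eq) (θ^-θ n eq′) (L.θ-step x q))
      where q = L.lift n m (θ x) (θ^-θ n eq)

    extend-inverse : ∀ {x} → x ⟶ u → L⁻¹.extend (L.extend x) ≡ x
    extend-inverse {x} (n , m , eq) =
      trans (L⁻¹.extend-lift n m (L.extend x) eq′)
            (lift-inverse n m x (L.extend x) eq eq′ (L.extend-lift n m x eq))
      where eq′ = L.θ^-extend n m eq

  -- The correspondence built from fibre bijections between points of equal type.

  module _ (fibres : ∀ x y → x ∼ y → θ⁻¹ x ↔ θ⁻¹ y) where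

    -- Noncyclicity is carried by `off` because it passes to preimages, where it lets the type be
    -- read off the image under θ.
    data Matched (u v p q : Carrier) : Set a where
      on  : ∀ i → p ≡ θ^ i u → q ≡ θ^ i v → Matched u v p q
      off : ¬ p ∈ ⟨ u ⟩′ → ¬ q ∈ ⟨ v ⟩′ → ¬ Cyclic p → ¬ Cyclic q → p ∼ q →
            Matched u v p q

    module _ {u v : Carrier} (u∼v : u ∼ v) where

      matched-∼ : ∀ {p q} → Matched u v p q → p ∼ q
      matched-∼ (on i refl refl)   = ⊑-θ^ i (proj₁ u∼v) , ⊑-θ^ i (proj₂ u∼v)
      matched-∼ (off _ _ _ _ p∼q) = p∼q

      matched-orbit : ∀ {p q} j → Matched u v p q → θ^ j u ≡ p → θ^ j v ≡ q
      matched-orbit j (on i refl refl) eq = proj₁ u∼v j i eq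
      matched-orbit j (off p∉ _ _ _ _) eq = contradiction (j , eq) p∉

      matched-orbit⁻¹ : ∀ {p q} j → Matched u v p q → θ^ j v ≡ q → θ^ j u ≡ p
      matched-orbit⁻¹ j (on i refl refl) eq = proj₂ u∼v j i eq
      matched-orbit⁻¹ j (off _ q∉ _ _ _) eq = contradiction (j , eq) q∉

      -- A cyclic `x` lies in ⟨ θ x ⟩ and makes `θ x` cyclic. The first is impossible if `θ x` is on
      -- the orbit that `x` avoids, the second if `θ x` is off it.
      matched-off : ∀ {x y} → Matched u v (θ x) (θ y) →
                    ¬ x ∈ ⟨ u ⟩′ → ¬ y ∈ ⟨ v ⟩′ → Matched u v x y
      matched-off {x} {y} r x∉ y∉ =
        off x∉ y∉ (¬cyclic-x r) (¬cyclic-y r)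
          ( ⊑-of-θ (¬cyclic-x r) (proj₁ (matched-∼ r))
          , ⊑-of-θ (¬cyclic-y r) (proj₂ (matched-∼ r)))
        where
        cyclic∈ : ∀ {w x} i → θ x ≡ θ^ i w → Cyclic x → x ∈ ⟨ w ⟩′
        cyclic∈ {w} i eq cyc with k , eq′ ← cyclic⇒∈⟨θ⟩ cyc =
          k + i , trans (θ^-+ 𝒜 k i w) (trans (cong (θ^ k) (sym eq)) eq′)
        ¬cyclic-x : Matched u v (θ x) (θ y) → ¬ Cyclic x
        ¬cyclic-x (on i eq _)      cyc = x∉ (cyclic∈ i eq cyc)
        ¬cyclic-x (off _ _ ¬c _ _) cyc = ¬c (θ-cyclic cyc)
        ¬cyclic-y : Matched u v (θ x) (θ y) → ¬ Cyclic y
        ¬cyclic-y (on i _ eq)      cyc = y∉ (cyclic∈ i eq cyc)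
        ¬cyclic-y (off _ _ _ ¬c _) cyc = ¬c (θ-cyclic cyc)

      -- By `orbit-fibre` only finitely many points of the fibre are on the orbit of `u`, so
      -- `prescribe` can make the given bijection follow the orbits.
      match : ∀ p q → Matched u v p q →
              Σ[ h ∈ θ⁻¹ p ↔ θ⁻¹ q ] ∀ z → Matched u v (value z) (value (Inverse.to h z))
      match p q r
        with is , cover ← orbit-fibre u p
        with h , h≡ ← prescribe em {I = ∃ λ j → θ^ (suc j) u ≡ p}
               (λ (j , eq) → θ^ j u , [ eq ])
               (λ (j , eq) → θ^ j v , [ matched-orbit (suc j) r eq ])
               (λ (i , _) (j , _) eq → value-injective (proj₁ u∼v i j (cong value eq)))
               (λ (i , _) (j , _) eq → value-injective (proj₂ u∼v i j (cong value eq)))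
               (fibres p q (matched-∼ r)) is
        = h , related
        where
        open Inverse h using (to)

        to-orbit : ∀ j (eq : θ^ (suc j) u ≡ p) → value (to (θ^ j u , [ eq ])) ≡ θ^ j v
        to-orbit j eq
          with (i , _) ← Any.lookup (cover (j , eq))
             | toᵢ , eqᵢ ← All.lookupAny h≡ (cover (j , eq)) =
          trans (cong (value ∘ to) (value-injective (sym eqᵢ)))
            (trans (cong value toᵢ) (proj₁ u∼v i j eqᵢ))

        related : ∀ z → Matched u v (value z) (value (to z))
        related (x , [ θx≡p ]) with em {x ∈ ⟨ u ⟩′}
        ... | yes (j , refl) = on j refl (to-orbit j (recompute em θx≡p))
        ... | no x∉ = matched-off
                (subst₂ (Matched u v) (sym (recompute em θx≡p)) (sym (fibre-θ (to z))) r) x∉ y∉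
          where
          z : θ⁻¹ p
          z = x , [ θx≡p ]
          y∉ : ¬ value (to z) ∈ ⟨ v ⟩′
          -- A point of the orbit of `v` in the fibre of `q` is already the image of the point of
          -- the orbit of `u` with the same index.
          y∉ (j , eq) = x∉ (j , cong value (↔-injective h (value-injective
            (trans (to-orbit j eq′) eq))))
            where
            eq′ : θ^ (suc j) u ≡ p
            eq′ = matched-orbit⁻¹ (suc j) r (trans (cong θ eq) (fibre-θ (to z)))

      correspondence : Correspondence u v
      correspondence = record
        { R            = Matched u v
        ; orbit        = λ i → on i refl refl
        ; functional   = λ i r → sym (matched-orbit i r refl)
        ; cofunctional = λ i r → sym (matched-orbit⁻¹ i r refl)
        ; fibre        = λ p q r → proj₁ (match p q (recompute em r))
        ; fibre-R      = λ p q r z → [ proj₂ (match p q (recompute em r)) z ]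
        }

  -- Exchanging two components of the complement of a closed set.

  module Avoiding (F : Pred Carrier a) (F-closed : ∀ {x} → F x → F (θ x)) where

    F-closed^ : ∀ n {x} → F x → F (θ^ n x)
    F-closed^ zero    Fx = Fx
    F-closed^ (suc n) Fx = F-closed (F-closed^ n Fx)

    infix 4 _≈_

    -- Connectedness within the complement of F.
    _≈_ : Carrier → Carrier → Set a
    x ≈ y = ∃₂ λ n m → θ^ n x ≡ θ^ m y × ¬ F (θ^ n x)

    ≈-sym : ∀ {x y} → x ≈ y → y ≈ x
    ≈-sym (n , m , eq , ∉F) = m , n , sym eq , ∉F ∘ subst F (sym eq)

    -- Of the two meeting points on the orbit of `y`, the later one lies on all three orbits, and it
    -- is outside `F` by assumption.
    ≈-trans : ∀ {x y z} → x ≈ y → y ≈ z → x ≈ z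
    ≈-trans {x} {y} {z} (n , m , eq , ∉F) (k , l , eq′ , ∉F′) with ≤-total m k
    ... | inj₁ m≤k = (k ∸ m) + n , l , trans x-meets-y eq′ , ∉F′ ∘ subst F x-meets-y
      where
      x-meets-y : θ^ ((k ∸ m) + n) x ≡ θ^ k y
      x-meets-y = trans (θ^-+ 𝒜 (k ∸ m) n x) (trans (cong (θ^ (k ∸ m)) eq) (θ^-∸ m≤k y))
    ... | inj₂ k≤m = n , (m ∸ k) + l , trans eq y-meets-z , ∉F
      where
      y-meets-z : θ^ m y ≡ θ^ ((m ∸ k) + l) z
      y-meets-z = trans (sym (θ^-∸ k≤m y)) (trans (cong (θ^ (m ∸ k)) eq′) (sym (θ^-+ 𝒜 (m ∸ k) l z)))

    ≈⇒∉F : ∀ {x y} → x ≈ y → ¬ F x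
    ≈⇒∉F (n , _ , _ , ∉F) = ∉F ∘ F-closed^ n

    θ-≈ : ∀ {x y} → θ x ≈ y → x ≈ y
    θ-≈ {x} (n , m , eq , ∉F) =
      suc n , m , trans (sym (θ^-comm 𝒜 n 1 x)) eq , ∉F ∘ subst F (sym (θ^-comm 𝒜 n 1 x))

    ≈⇒⟶ : ∀ {x y} → x ≈ y → x ⟶ y
    ≈⇒⟶ (n , m , eq , _) = n , m , eq

    module _ {u v} (C : Correspondence u v)
             (agree : ∀ n → F (θ^ n u) ⊎ F (θ^ n v) → θ^ n u ≡ θ^ n v) where
      open Lift C

      -- If θᵐ v were in `F`, then `agree` would identify it with θᵐ u, which is outside `F`.
      extend-≈ : ∀ {x} → x ≈ u → extend x ≈ v
      extend-≈ (n , m , eq , ∉F) =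
        n , m , eq′ , λ ∈F → ∉F (subst F
          (sym (trans eq (agree m (inj₂ (subst F eq′ ∈F))))) (subst F eq′ ∈F))
        where eq′ = θ^-extend n m eq

      -- One application of θ can leave the component only from the orbit of `u`, entering `F`;
      -- there `agree` identifies the two orbits.
      leave : ∀ {x} → x ≈ u → θ x ≈ u ⊎ (F (θ x) × θ (extend x) ≡ θ x)
      leave {x} (suc n , m , eq , ∉F) =
        inj₁ (n , m , θ^-θ n eq , ∉F ∘ subst F (θ^-comm 𝒜 n 1 x))
      leave {x} (zero , m , refl , ∉F) with em {F (θ x)}
      ... | no  θx∉F = inj₁ (0 , suc m , refl , θx∉F)
      ... | yes θx∈F =
        inj₂ (θx∈F , trans (cong θ (extend-orbit m)) (sym (agree (suc m) (inj₁ θx∈F))))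

    module _ {u v} (C : Correspondence u v)
             (agree : ∀ n → F (θ^ n u) ⊎ F (θ^ n v) → θ^ n u ≡ θ^ n v) where
      private
        module L = Lift C
        module L⁻¹ = Lift (opposite C)
        agree⁻¹ : ∀ n → F (θ^ n v) ⊎ F (θ^ n u) → θ^ n v ≡ θ^ n u
        agree⁻¹ n = sym ∘ agree n ∘ swap

      exchangeable : Exchangeable (_≈ u) (_≈ v) L.extend L⁻¹.extend
      exchangeable = record
        { to-∈     = extend-≈ C agree
        ; from-∈   = extend-≈ (opposite C) agree⁻¹
        ; from∘to  = extend-inverse C ∘ ≈⇒⟶
        ; to∘from  = extend-inverse (opposite C) ∘ ≈⇒⟶
        ; overlapˡ = λ x≈u x≈v y≈v → ≈-trans y≈v (≈-trans (≈-sym x≈v) x≈u)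
        ; overlapʳ = λ x≈u x≈v y≈u → ≈-trans y≈u (≈-trans (≈-sym x≈u) x≈v)
        }

      permute : Carrier → Carrier
      permute = exchange em (_≈ u) (_≈ v) L.extend L⁻¹.extend

      permute-fixes : ∀ {x} → F x → permute x ≡ x
      permute-fixes Fx = exchange-off em (λ x≈u → ≈⇒∉F x≈u Fx) (λ x≈v → ≈⇒∉F x≈v Fx)

      permute-moves : permute u ≡ v
      permute-moves with em {F u}
      ... | no  u∉F = trans (exchange-fst em (0 , 0 , refl , u∉F)) (L.extend-orbit 0)
      ... | yes u∈F = trans (permute-fixes u∈F) (agree 0 (inj₁ u∈F))

      -- Inside a component `extend` commutes with θ, and a step out of it ends in `F`, which is
      -- fixed pointwise. A point outside both components has its image under θ outside both.
      permute-homo : ∀ x → permute (θ x) ≡ θ (permute x)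
      permute-homo x with em {x ≈ u} | em {x ≈ v}
      permute-homo x | yes x≈u | _ with leave C agree x≈u
      ... | inj₁ θx≈u         = trans (exchange-fst em θx≈u) (L.extend-θ (≈⇒⟶ x≈u))
      ... | inj₂ (θx∈F , eq) = trans (permute-fixes θx∈F) (sym eq)
      permute-homo x | no x≉u | yes x≈v with leave (opposite C) agree⁻¹ x≈v
      ... | inj₁ θx≈v         =
        trans (exchange-snd em (x≉u ∘ θ-≈) θx≈v) (L⁻¹.extend-θ (≈⇒⟶ x≈v))
      ... | inj₂ (θx∈F , eq) = trans (permute-fixes θx∈F) (sym eq)
      permute-homo x | no x≉u | no x≉v = exchange-off em (x≉u ∘ θ-≈) (x≉v ∘ θ-≈)

      automorphism : 𝒜 ≅ 𝒜
      automorphism = record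
        { bijection = exchange-↔ em exchangeable
        ; homo      = permute-homo
        }

  -- Types of points and isomorphisms of subalgebras.

  module _ (B C : Subalgebra 𝒜) where

    value-homo : (φ : algebra B ≅ algebra C) → ∀ n z →
                 value (_≅_.to φ (MonounaryAlgebra.θ^ (algebra B) n z)) ≡
                 θ^ n (value (_≅_.to φ z))
    value-homo φ n z = trans (cong value (homo-θ^ φ n z)) (value-θ^ 𝒜 C n _)

    subalgebra-⊑ : (φ : algebra B ≅ algebra C) → ∀ z → value z ⊑ value (_≅_.to φ z)
    subalgebra-⊑ φ z n m eq = begin
      θ^ n (value (to z))   ≡⟨ value-homo φ n z ⟨
      value (to (θᴮ^ n z))  ≡⟨ cong (value ∘ to) (value-injective (begin
        value (θᴮ^ n z)       ≡⟨ value-θ^ 𝒜 B n z ⟩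
        θ^ n (value z)        ≡⟨ eq ⟩
        θ^ m (value z)        ≡⟨ value-θ^ 𝒜 B m z ⟨
        value (θᴮ^ m z)       ∎)) ⟩
      value (to (θᴮ^ m z))  ≡⟨ value-homo φ m z ⟩
      θ^ m (value (to z))   ∎
      where
      open _≅_ φ
      open MonounaryAlgebra (algebra B) using () renaming (θ^ to θᴮ^)
      open ≡-Reasoning

  subalgebra-∼ : (B C : Subalgebra 𝒜) (φ : algebra B ≅ algebra C) →
                 ∀ z → value z ∼ value (_≅_.to φ z)
  subalgebra-∼ B C φ z =
      subalgebra-⊑ B C φ z
    , subst (value (to z) ⊑_) (cong value (Inverse.strictlyInverseʳ bijection z))
            (subalgebra-⊑ C B (≅-sym φ) (to z))
    where open _≅_ φ

  automorphism-∼ : (α : 𝒜 ≅ 𝒜) → ∀ x → x ∼ _≅_.to α x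
  automorphism-∼ α x =
      (λ n m eq → trans (sym (homo-θ^ α n x)) (trans (cong to eq) (homo-θ^ α m x)))
    , (λ n m eq → ↔-injective bijection (trans (homo-θ^ α n x) (trans eq (sym (homo-θ^ α m x)))))
    where open _≅_ α

  generator : ∀ x → MonounaryAlgebra.Carrier (algebra (⟨_⟩ 𝒜 x))
  generator x = x , [ 0 , refl ]

  exponent : ∀ {x} (z : [ z ∈ Carrier ∣ z ∈ ⟨ x ⟩′ ]) → ∃ λ n → θ^ n x ≡ value z
  exponent (_ , [ z∈ ]) = recompute em z∈

  -- The image of the generator `x` need not be `y`, only some θᵏ y; but equations at `y` persist at
  -- θᵏ y and pull back to `x`.
  ≅⇒⊑ : ∀ {x y} → algebra (⟨_⟩ 𝒜 x) ≅ algebra (⟨_⟩ 𝒜 y) → y ⊑ x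
  ≅⇒⊑ {x} {y} φ n m eq with k , θᵏy≡φx ← exponent (_≅_.to φ (generator x)) =
    proj₂ (subalgebra-∼ (⟨_⟩ 𝒜 x) (⟨_⟩ 𝒜 y) φ (generator x)) n m (begin
      θ^ n (value (_≅_.to φ (generator x))) ≡⟨ cong (θ^ n) θᵏy≡φx ⟨
      θ^ n (θ^ k y)                         ≡⟨ θ^-comm 𝒜 n k y ⟩
      θ^ k (θ^ n y)                         ≡⟨ cong (θ^ k) eq ⟩
      θ^ k (θ^ m y)                         ≡⟨ θ^-comm 𝒜 k m y ⟩
      θ^ m (θ^ k y)                         ≡⟨ cong (θ^ m) θᵏy≡φx ⟩
      θ^ m (value (_≅_.to φ (generator x))) ∎)
    where open ≡-Reasoning

  ≅⇒∼ : ∀ {x y} → algebra (⟨_⟩ 𝒜 x) ≅ algebra (⟨_⟩ 𝒜 y) → x ∼ y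
  ≅⇒∼ φ = ≅⇒⊑ (≅-sym φ) , ≅⇒⊑ φ

  module _ {x y : Carrier} where

    -- The exponent is an arbitrary one reaching `z`; by `transport-θ^` its choice is immaterial
    -- once x ⊑ y.
    transport : [ z ∈ Carrier ∣ z ∈ ⟨ x ⟩′ ] → [ z ∈ Carrier ∣ z ∈ ⟨ y ⟩′ ]
    transport z = θ^ (proj₁ (exponent z)) y , [ proj₁ (exponent z) , refl ]

    transport-θ^ : x ⊑ y → ∀ n z → value z ≡ θ^ n x → value (transport z) ≡ θ^ n y
    transport-θ^ x⊑y n z eq = x⊑y (proj₁ (exponent z)) n (trans (proj₂ (exponent z)) eq)

  transport-inverse : ∀ {x y} → y ⊑ x → ∀ z → transport {y} {x} (transport {x} {y} z) ≡ z
  transport-inverse y⊑x z = value-injective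
    (trans (transport-θ^ y⊑x (proj₁ (exponent z)) (transport z) refl) (proj₂ (exponent z)))

  ∼⇒≅ : ∀ {x y} → x ∼ y → algebra (⟨_⟩ 𝒜 x) ≅ algebra (⟨_⟩ 𝒜 y)
  ∼⇒≅ {x} {y} (x⊑y , y⊑x) = record
    { bijection = mk↔ₛ′ transport transport (transport-inverse x⊑y) (transport-inverse y⊑x)
    ; homo      = homo
    }
    where
    homo : ∀ z → transport {x} {y} (MonounaryAlgebra.θ (algebra (⟨_⟩ 𝒜 x)) z) ≡
                 MonounaryAlgebra.θ (algebra (⟨_⟩ 𝒜 y)) (transport z)
    homo z = value-injective
      (transport-θ^ x⊑y (suc (proj₁ (exponent z))) (MonounaryAlgebra.θ (algebra (⟨_⟩ 𝒜 x)) z)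
        (cong θ (sym (proj₂ (exponent z)))))

  -- Components, and restrictions of automorphisms to fibres and components.

  closed^ : ∀ (B : Subalgebra 𝒜) n {x} → x ∈ member B → θ^ n x ∈ member B
  closed^ B zero    x∈B = x∈B
  closed^ B (suc n) x∈B = closed B (closed^ B n x∈B)

  module _ (D : Subalgebra 𝒜) (component : IsConnectedComponent 𝒜 D)
           {x : Carrier} (x∈D : x ∈ member D) where

    component⇒⟶ : ∀ {z} → z ∈ member D → x ⟶ z
    component⇒⟶ {z} z∈D
      with n , m , eq ← proj₁ component (x , [ x∈D ]) (z , [ z∈D ]) =
      n , m , trans (sym (value-θ^ 𝒜 D n _)) (trans (cong value eq) (value-θ^ 𝒜 D m _))

    ⟶⇒component : ∀ {z} → x ⟶ z → z ∈ member D
    ⟶⇒component =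
      -- `E` consists of the points z with x ⟶ z, so it contains `D`, and maximality of `D` gives
      -- the converse inclusion.
      let E , (connected , _) , _ = connectedComponent 𝒜 em x
      in proj₂ component E connected component⇒⟶

  module _ (α : 𝒜 ≅ 𝒜) where
    open _≅_ α

    automorphism-fibre : ∀ x → θ⁻¹ x ↔ θ⁻¹ (to x)
    automorphism-fibre x = mk↔ₛ′
      (λ (z , [ eq ]) → to z , [ trans (sym (homo z)) (cong to eq) ])
      (λ (z , [ eq ]) → from z , [ trans (sym (_≅_.homo (≅-sym α) z))
                                     (trans (cong from eq) (strictlyInverseʳ x)) ])
      (λ z → value-injective (strictlyInverseˡ (value z)))
      (λ z → value-injective (strictlyInverseʳ (value z)))
      where open Inverse bijection using (strictlyInverseˡ; strictlyInverseʳ)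

    automorphism-⟶ : ∀ {x z} → x ⟶ z → to x ⟶ to z
    automorphism-⟶ (n , m , eq) =
      n , m , trans (sym (homo-θ^ α n _)) (trans (cong to eq) (homo-θ^ α m _))

    restrict : (D E : Subalgebra 𝒜) → (∀ {z} → z ∈ member D → to z ∈ member E) →
               (∀ {z} → z ∈ member E → from z ∈ member D) → algebra D ≅ algebra E
    restrict D E to-∈ from-∈ = record
      { bijection = mk↔ₛ′
          (λ (z , [ z∈ ]) → to z , [ to-∈ z∈ ])
          (λ (z , [ z∈ ]) → from z , [ from-∈ z∈ ])
          (λ z → value-injective (strictlyInverseˡ (value z)))
          (λ z → value-injective (strictlyInverseʳ (value z)))
      ; homo = λ z → value-injective (homo (value z))
      }
      where open Inverse bijection using (strictlyInverseˡ; strictlyInverseʳ)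

  -- From ultrahomogeneity to isomorphic fibres and components.

  OrbitHomogeneous : Set (lsuc a)
  OrbitHomogeneous = ∀ x y → algebra (⟨_⟩ 𝒜 x) ≅ algebra (⟨_⟩ 𝒜 y) →
    (θ⁻¹ x ↔ θ⁻¹ y) ×
    (∀ (D E : Subalgebra 𝒜) →
      IsConnectedComponent 𝒜 D → x ∈ member D →
      IsConnectedComponent 𝒜 E → y ∈ member E →
      algebra D ≅ algebra E)

  ⟨⟩-finitelyGenerated : ∀ x → FinitelyGenerated 𝒜 (⟨_⟩ 𝒜 x)
  ⟨⟩-finitelyGenerated x =
    x ∷ [] , (0 , refl) ∷ [] , λ { C (x∈C ∷ []) (n , refl) → closed^ C n x∈C }

  ultrahomogeneous⇒ : Ultrahomogeneous 𝒜 → OrbitHomogeneous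
  ultrahomogeneous⇒ ultra x y φ
    -- `φ` may move `x` to a point other than `y`, so it is replaced by the isomorphism θⁿ x ↦ θⁿ y;
    -- its extension α satisfies α x = y.
    with x∼y ← ≅⇒∼ φ
    with α , extends ← ultra (⟨_⟩ 𝒜 x) (⟨_⟩ 𝒜 y)
           (⟨⟩-finitelyGenerated x) (⟨⟩-finitelyGenerated y) (∼⇒≅ x∼y)
    with refl ← trans (extends (generator x))
                      (transport-θ^ (proj₁ x∼y) 0 (generator x) refl) =
    automorphism-fibre α x , λ D E cD x∈D cE y∈E →
      restrict α D E
        (λ z∈D → ⟶⇒component E cE y∈E (automorphism-⟶ α (component⇒⟶ D cD x∈D z∈D)))
        (λ z∈E → ⟶⇒component D cD x∈D
          (subst (_⟶ _) (Inverse.strictlyInverseʳ (_≅_.bijection α) x)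
            (automorphism-⟶ (≅-sym α) (component⇒⟶ E cE y∈E z∈E))))

  -- Extending an isomorphism one generator at a time.

  module _ (fibres : ∀ x y → x ∼ y → θ⁻¹ x ↔ θ⁻¹ y)
           {B C : Subalgebra 𝒜} (φ : algebra B ≅ algebra C) where
    private
      module φ = _≅_ {𝒜 = algebra B} {ℬ = algebra C} φ

    -- The equalizer of `α` and `φ`. It is closed under θ, so it contains `B` as soon as it contains
    -- generators of `B`.
    Agree : 𝒜 ≅ 𝒜 → Pred Carrier a
    Agree α x = Σ[ x∈B ∈ x ∈ member B ] _≅_.to α x ≡ value (φ.to (x , [ x∈B ]))

    agree-θ : ∀ α {x} → Agree α x → Agree α (θ x)
    agree-θ α {x} (x∈B , eq) =
      closed B x∈B , trans (_≅_.homo α x)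
                       (trans (cong θ eq) (sym (cong value (φ.homo (x , [ x∈B ])))))

    extend-to : ∀ {xs} → All (_∈ member B) xs → Σ[ α ∈ 𝒜 ≅ 𝒜 ] All (Agree α) xs
    extend-to [] = ≅-refl , []
    extend-to {x ∷ _} (x∈B ∷ xs∈B) with α , agrees ← extend-to xs∈B =
      ≅-trans α β , (x∈B , automorphism-moves) ∷ All.map keep agrees
      where
      module α = _≅_ α

      -- `β` is applied after `α`, so what it has to fix are images under `α`.
      F : Pred Carrier a
      F w = ∃ λ b → Agree α b × α.to b ≡ w

      F-closed : ∀ {w} → F w → F (θ w)
      F-closed (b , agr , refl) = θ b , agree-θ α agr , α.homo b

      open Avoiding F F-closed

      z : MonounaryAlgebra.Carrier (algebra B)
      z = x , [ x∈B ]

      u = α.to x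
      v = value (φ.to z)

      u∼v : u ∼ v
      u∼v = ∼-trans (∼-sym (automorphism-∼ α x)) (subalgebra-∼ B C φ z)

      zⁿ : ℕ → MonounaryAlgebra.Carrier (algebra B)
      zⁿ n = MonounaryAlgebra.θ^ (algebra B) n z

      agree-on : ∀ n {b} → Agree α b → b ≡ θ^ n x → θ^ n u ≡ θ^ n v
      agree-on n (b∈B , eq) refl = begin
        θ^ n u                          ≡⟨ homo-θ^ α n x ⟨
        α.to (θ^ n x)                   ≡⟨ eq ⟩
        value (φ.to (θ^ n x , [ b∈B ])) ≡⟨ cong (value ∘ φ.to)
                                             (value-injective (value-θ^ 𝒜 B n z)) ⟨
        value (φ.to (zⁿ n))             ≡⟨ value-homo B C φ n z ⟩
        θ^ n v                          ∎
        where open ≡-Reasoning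

      -- A point of `F` is the common image of some b under `α` and `φ`. Injectivity of `α` on the
      -- orbit of `u`, and of `φ` on that of `v`, forces b = θⁿ x.
      agree : ∀ n → F (θ^ n u) ⊎ F (θ^ n v) → θ^ n u ≡ θ^ n v
      agree n (inj₁ (b , agr , eq)) =
        agree-on n agr (↔-injective α.bijection (trans eq (sym (homo-θ^ α n x))))
      agree n (inj₂ (b , agr@(b∈B , eqᵇ) , eq)) =
        agree-on n agr (trans (cong value (↔-injective φ.bijection
          {b , [ b∈B ]} {zⁿ n} (value-injective (begin
            value (φ.to (b , [ b∈B ])) ≡⟨ eqᵇ ⟨
            α.to b                     ≡⟨ eq ⟩
            θ^ n v                     ≡⟨ value-homo B C φ n z ⟨
            value (φ.to (zⁿ n))        ∎)))) (value-θ^ 𝒜 B n z))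
        where open ≡-Reasoning

      C′ : Correspondence u v
      C′ = correspondence fibres u∼v

      β : 𝒜 ≅ 𝒜
      β = automorphism C′ agree

      automorphism-moves : _≅_.to β u ≡ v
      automorphism-moves = permute-moves C′ agree

      keep : ∀ {w} → Agree α w → Agree (≅-trans α β) w
      keep {w} agr@(w∈B , eq) = w∈B , trans (permute-fixes C′ agree (w , agr , refl)) eq

    -- The list of generators may be empty when B lies in every subalgebra, so a
    -- point of B is added to it.
    fibres⇒extends : FinitelyGenerated 𝒜 B → Σ[ α ∈ 𝒜 ≅ 𝒜 ] Extends 𝒜 {B} {C} α φ
    fibres⇒extends (xs , xs∈B , generate)
      with x , x∈B ← inhabited B
      with α , agree-x ∷ agree-xs ← extend-to (x∈B ∷ xs∈B) =
      α , λ (z , [ z∈B ]) → proj₂ (generate (agreement α agree-x) agree-xs (recompute em z∈B))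
      where
      agreement : ∀ α {x} → Agree α x → Subalgebra 𝒜
      agreement α {x} agr = record
        { member    = Agree α
        ; inhabited = x , agr
        ; closed    = agree-θ α
        }

theorem4p7 : ∀ {a : Level} → ExcludedMiddle a →
    (𝒜 : MonounaryAlgebra a) →
    let open MonounaryAlgebra 𝒜
        open Subalgebra
    in
    Ultrahomogeneous 𝒜 ⇔
      (∀ (x y : Carrier) → algebra (⟨_⟩ 𝒜 x) ≅ algebra (⟨_⟩ 𝒜 y) →
        (θ⁻¹ x ↔ θ⁻¹ y) ×
        (∀ (D E : Subalgebra 𝒜) →
          IsConnectedComponent 𝒜 D → x ∈ member D →
          IsConnectedComponent 𝒜 E → y ∈ member E →
          algebra D ≅ algebra E))
theorem4p7 em 𝒜 = mk⇔ (ultrahomogeneous⇒ em 𝒜)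
  (λ H B C B-fg _ φ →
    fibres⇒extends em 𝒜 (λ x y x∼y → proj₁ (H x y (∼⇒≅ em 𝒜 x∼y))) {B} {C} φ B-fg)
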